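{- Let $s$ be a visible pointer structure, let $i\leq|s|-1$, let $a,b$ be skeletons and $d\in\mathbb{N}$, and suppose $(s,i)\in a\star_d b$. If $s_{i+1}$ is defined (i.e. $i+1\leq|s|-1$), then there exist skeletons $a',b'$ and $d'\in\mathbb{N}$ such that $(a,d,b)\leadsto(a',d',b')$ and $(s,i+1)\in a'\star_{d'}b'$.
   Context: **Pointer structures.** A pointer structure is a finite sequence $s=s_0\dots s_{k-1}$ of natural numbers (moves) such that: $0$ (the initial move) occurs at most once and carries no pointer; each move $s_j\neq0$ carries a pointer to an earlier move $s_i$ with $s_j=s_i+1$ (written $s_j\to s_i$); consecutive moves have different parities. Even moves are Opponent (O) moves, odd moves Player (P) moves. $|s|$ is the length; $s_{\leq i}=s_0\dots s_i$ and $s_{<i}=s_0\dots s_{i-1}$. **Views.** P-view: $\ulcorner\varepsilon\urcorner=\varepsilon$; $\ulcorner sm\urcorner=\ulcorner s\urcorner m$ if $m$ is a P-move; $\ulcorner sm\urcorner=m$ if $m$ is initial; $\ulcorner s_1ms_2n\urcorner=\ulcorner s_1\urcorner mn$ if $n$ is a non-initial O-move pointing to $m$. O-view: $\llcorner\varepsilon\lrcorner=\varepsilon$; $\llcorner sm\lrcorner=\llcorner s\lrcorner m$ if $m$ is an O-move; $\llcorner s_1ms_2n\lrcorner=\llcorner s_1\lrcorner mn$ if $n$ is a P-move pointing to $m$. $s$ is visible if for every prefix $s'a$, a P-move $a$ points to a move of $\ulcorner s'\urcorner$, and a non-initial O-move $a$ points to a move of $\llcorner s'\lrcorner$. **Residual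 quantities.** A pointed visible pointer structure is a pair $(s,i)$ with $s$ visible and $i\leq|s|-1$. Below, "$s_i\in$ view of $s_{\leq j}$" means that this particular move occurrence is kept in the view. If $s_i$ is an O-move, $\mathrm{rsize}(s,i)=\max_{j:\,s_i\in\ulcorner s_{\leq j}\urcorner}|\ulcorner s_{\leq j}\urcorner|-|\ulcorner s_{\leq i}\urcorner|+1$ and $\mathrm{rcosize}(s,i)=\max_{j:\,s_i\in\llcorner s_{\leq j}\lrcorner}|\llcorner s_{\leq j}\lrcorner|-|\llcorner s_{\leq i}\lrcorner|+1$; if $s_i$ is a P-move, P-views and O-views are exchanged in both definitions. The residual depth of $s$ at $i$ is the maximal length (number of pointers) of a chain $s_i\leftarrow s_{j_1}\leftarrow s_{j_2}\leftarrow\cdots$ of pointers in $s$ starting from $s_i$. **Context and co-context.** The context of $(s,i)$ is, if $s_i$ is an O-move, the set of O-moves other than $s_i$ appearing in $\ulcorner s_{\leq i}\urcorner$, and if $s_i$ is a P-move, the set of P-moves other than $s_i$ appearing in $\llcorner s_{\leq i}\lrcorner$ (i.e. the moves other than $s_i$ to which $s_{i+1}$ may point under visibility). The co-context of $(s,i)$ is, if $s_i$ is an O-move, the set of P-moves appearing in $\llcorner s_{<i}\lrcorner$, and if $s_i$ is a P-move, the set of O-moves appearing in $\ulcorner s_{<i}\urcorner$. They are enumerated $\{s_{n_1},\dots,s_{n_p}\}$ with $n_1<\dots<n_p$. **Skeletons.** A skeleton is a finite tree with nodes and edges labeled by natural numbers; $n[\{d_1\}a_1,\dots,\{d_p\}a_p]$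 has root label $n$ and subtrees $a_k$ along edges labeled $d_k$. **Traces.** Let $a=n[\{d_1\}a_1,\dots,\{d_p\}a_p]$. We say $(s,i)\in Tr(a)$ (resp. $(s,i)\in coTr(a)$), by recursion on $a$, if: (1) $\mathrm{rsize}(s,i)\leq 2n$ (resp. $\mathrm{rcosize}(s,i)\leq 2n+1$); (2) the context (resp. co-context) of $(s,i)$ has exactly $p$ elements $s_{n_1},\dots,s_{n_p}$, and for each $k\in\{1,\dots,p\}$, $(s,n_k)\in coTr(a_k)$; (3) for each $k$, the residual depth of $s$ at $n_k$ is at most $d_k$. Finally $(s,i)\in a\star_d b$ means $(s,i)\in Tr(a)\cap coTr(b)$ and the residual depth of $s$ at $i$ is at most $d$. **Reduction on triples.** For $n>0$, $$(n[\{d_1\}a_1,\dots,\{d_p\}a_p],d,b)\leadsto(a_i,d_i-1,(n-1)[\{d_1\}a_1,\dots,\{d_p\}a_p,\{d\}b])\quad(1\leq i\leq p,\ d_i>0),$$ $$(n[\{d_1\}a_1,\dots,\{d_p\}a_p],d,b)\leadsto(b,d-1,(n-1)[\{d_1\}a_1,\dots,\{d_p\}a_p,\{d\}b])\quad(d>0).$$ -}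

module Defs where

open import Data.Fin.Base using (Fin; zero; suc; toℕ; inject₁; _<_)
open import Data.Fin.Induction using (<-wellFounded)
open import Data.Fin.Properties using (any?; ≤̄⇒inject₁<; ≤-refl) renaming (_≟_ to _≟ᶠ_)
open import Data.List.Base using (List; []; _∷_; _∷ʳ_; _++_; map; filter; length; allFin; upTo)
open import Data.List.Extrema.Nat using (max)
open import Data.List.Membership.Propositional using (_∈_)
open import Data.List.Relation.Binary.Pointwise using (Pointwise)
open import Data.Maybe.Base using (Maybe; just; nothing)
open import Data.Maybe.Properties using (≡-dec)
open import Data.Nat.Base using (ℕ; zero; suc; _+_; _*_; _∸_; _≤_; parity)
open import Data.Parity.Base using (Parity; 0ℙ; 1ℙ; _⁻¹)
open import Data.Parity.Properties using (_≟_)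
open import Data.Product.Base using (_×_; _,_; ∃)
open import Data.Unit.Base using (⊤; tt)
open import Induction.WellFounded using (Acc; acc)
open import Relation.Binary.PropositionalEquality using (_≡_; _≢_; refl)
open import Relation.Nullary.Decidable using (Dec; yes; no; _×-dec_; ¬?)

import Data.List.Membership.DecPropositional as DecMembership

-- Opponent moves are the even ones, Player moves the odd ones, so a polarity
-- is a parity: O = 0ℙ, P = 1ℙ, and _⁻¹ exchanges the two players.

record PointerStructure (k : ℕ) : Set where
  field
    move            : Fin k → ℕ
    pointer         : Fin k → Maybe (Fin k)
    initial-unique  : ∀ {i j} → move i ≡ 0 → move j ≡ 0 → i ≡ j
    initial-pointer : ∀ {j} → move j ≡ 0 → pointer j ≡ nothing
    pointer-defined : ∀ {j} → move j ≢ 0 → ∃ λ i → pointer j ≡ just i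
    pointer-earlier : ∀ {i j} → pointer j ≡ just i → i < j
    pointer-move    : ∀ {i j} → pointer j ≡ just i → move j ≡ suc (move i)
    alternating     : ∀ {i j} → toℕ j ≡ suc (toℕ i) →
                      parity (move i) ≢ parity (move j)

  polarity : Fin k → Parity
  polarity i = parity (move i)

-- Views are lists of move occurrences, i.e. of positions in s, in increasing
-- order. The view of player x is the P-view for x = 1ℙ and the O-view for
-- x = 0ℙ. The two share their defining clauses: since initial moves are
-- O-moves, the clause for a move without pointer is only reached in P-views.

mutual
  viewUpToAcc : ∀ {k} → PointerStructure k → Parity → (j : Fin k) → Acc _<_ j → List (Fin k)
  viewUpToAcc s x j ac = viewStep s x j ac (PointerStructure.polarity s j ≟ x)
                                  (PointerStructure.pointer s j)
                                  (PointerStructure.pointer-earlier s)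

  viewStep : ∀ {k} → PointerStructure k → (x : Parity) (j : Fin k) → Acc _<_ j →
             {own : Set} → Dec own →
             (p : Maybe (Fin k)) → (∀ {i} → p ≡ just i → i < j) → List (Fin k)
  viewStep s x j ac       (yes _) _        _       = viewBeforeAcc s x j ac ∷ʳ j
  viewStep s x j ac       (no _)  nothing  _       = j ∷ []
  viewStep s x j (acc rs) (no _)  (just i) earlier =
    viewBeforeAcc s x i (rs (earlier refl)) ++ i ∷ j ∷ []

  viewBeforeAcc : ∀ {k} → PointerStructure k → Parity → (j : Fin k) → Acc _<_ j → List (Fin k)
  viewBeforeAcc s x zero    _        = []
  viewBeforeAcc s x (suc j) (acc rs) =
    viewUpToAcc s x (inject₁ j) (rs (≤̄⇒inject₁< (≤-refl {x = j})))

module _ {k : ℕ} (s : PointerStructure k) where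
  open PointerStructure s
  open DecMembership (_≟ᶠ_ {k}) using (_∈?_)

  -- The view of s_{≤ j}.
  viewUpTo : Parity → Fin k → List (Fin k)
  viewUpTo x j = viewUpToAcc s x j (<-wellFounded j)

  -- The view of s_{< j}.
  viewBefore : Parity → Fin k → List (Fin k)
  viewBefore x j = viewBeforeAcc s x j (<-wellFounded j)

  Visible : Set
  Visible = ∀ {i j} → pointer j ≡ just i → i ∈ viewBefore (polarity j) j

  -- The default 0 of the maximum is immaterial, and the truncated subtraction
  -- exact, because s_i lies in its own view of s_{≤ i}.
  residual : Parity → Fin k → ℕ
  residual x i =
    max 0 (map (λ j → length (viewUpTo x j))
               (filter (λ j → i ∈? viewUpTo x j) (allFin k)))
      ∸ length (viewUpTo x i) + 1

  rsize : Fin k → ℕ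
  rsize i = residual (polarity i ⁻¹) i

  rcosize : Fin k → ℕ
  rcosize i = residual (polarity i) i

  -- Chain n i: there is a chain s_i ← s_{j₁} ← … ← s_{jₙ} of n pointers.
  Chain : ℕ → Fin k → Set
  Chain zero    i = ⊤
  Chain (suc n) i = ∃ λ j → pointer j ≡ just i × Chain n j

  chain? : ∀ n i → Dec (Chain n i)
  chain? zero    i = yes tt
  chain? (suc n) i = any? λ j → ≡-dec _≟ᶠ_ (pointer j) (just i) ×-dec chain? n j

  -- Restricting to n < k loses nothing: a chain of n pointers visits n + 1
  -- distinct positions of s.
  rdepth : Fin k → ℕ
  rdepth i = max 0 (filter (λ n → chain? n i) (upTo k))

  -- Both sets are enumerated in increasing order, as views are.
  context : Fin k → List (Fin k)
  context i = filter (λ m → (polarity m ≟ polarity i) ×-dec ¬? (m ≟ᶠ i))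
                     (viewUpTo (polarity i ⁻¹) i)

  cocontext : Fin k → List (Fin k)
  cocontext i = filter (λ m → polarity m ≟ polarity i ⁻¹) (viewBefore (polarity i) i)

-- n [ (d₁ , a₁) ∷ … ∷ (dₚ , aₚ) ∷ [] ] has subtree aₖ along an edge labelled dₖ.
data Skeleton : Set where
  _[_] : ℕ → List (ℕ × Skeleton) → Skeleton

module _ {k : ℕ} (s : PointerStructure k) where
  mutual
    data Tr : Skeleton → Fin k → Set where
      tr : ∀ {n as i} → rsize s i ≤ 2 * n →
           Pointwise Fits as (context s i) →
           Tr (n [ as ]) i

    data CoTr : Skeleton → Fin k → Set where
      cotr : ∀ {n as i} → rcosize s i ≤ 2 * n + 1 →
             Pointwise Fits as (cocontext s i) →
             CoTr (n [ as ]) i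

    data Fits : ℕ × Skeleton → Fin k → Set where
      fits : ∀ {d a m} → CoTr a m → rdepth s m ≤ d → Fits (d , a) m

⟨_,_⟩∈_⋆[_]_ : ∀ {k} → PointerStructure k → Fin k → Skeleton → ℕ → Skeleton → Set
⟨ s , i ⟩∈ a ⋆[ d ] b = Tr s a i × CoTr s b i × rdepth s i ≤ d

infix 4 _↝_

data _↝_ : Skeleton × ℕ × Skeleton → Skeleton × ℕ × Skeleton → Set where
  toChild : ∀ {n as d b dᵢ aᵢ} → (suc dᵢ , aᵢ) ∈ as →
            (suc n [ as ] , d , b) ↝ (aᵢ , dᵢ , n [ as ∷ʳ (d , b) ])
  toArg   : ∀ {n as d b} →
            (suc n [ as ] , suc d , b) ↝ (b , d , n [ as ∷ʳ (suc d , b) ])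

{-# OPTIONS --safe #-}

-- If s_j points to s_m, then the view of s_{≤ j} by the player of s_m is the
-- view of s_{≤ m} followed by s_j, so that every view through s_j also goes
-- through s_m: the residual size of s_j is less than the residual cosize of
-- s_m, and the context of s_j is the cocontext of s_m. A cotrace of s_m is
-- therefore a trace of s_j. Similarly the view of s_{≤ i+1} by its own player
-- is the view of s_{≤ i} followed by s_{i+1}, whence the new cotrace. By
-- visibility s_{i+1} points either to s_i, as in toArg, or into the context of
-- s_i, as in toChild.

module Submission where

open import Defs
open import Data.Fin.Base using (Fin; zero; suc; toℕ; inject₁; _<_)
open import Data.Fin.Induction using (<-wellFounded)
open import Data.Fin.Properties using (toℕ<n; toℕ-inject₁; toℕ-injective) renaming (_≟_ to _≟ᶠ_; <⇒≢ to <⇒≢ᶠ)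
open import Data.List.Base using ([]; _∷_; _∷ʳ_; _++_; map; filter; length; allFin; upTo)
open import Data.List.Extrema.Nat using (max; xs≤max; argmax-all; max-mono-⊆)
open import Data.List.Membership.Propositional using (_∈_)
open import Data.List.Membership.Propositional.Properties
  using (∈-++⁻; ∈-++⁺ˡ; ∈-++⁺ʳ; ∈-filter⁺; ∈-map⁺; ∈-allFin; ∈-upTo⁺)
open import Data.List.Properties
  using (++-assoc; ++-identityʳ; length-++; filter-++; filter-reject; filter-accept; ∷ʳ-injectiveˡ)
open import Data.List.Relation.Binary.Pointwise using (Pointwise; []; _∷_; ++⁺)
open import Data.List.Relation.Binary.Subset.Propositional using (_⊆_)
open import Data.List.Relation.Binary.Subset.Propositional.Properties using (⊆-refl; map⁺; filter⁺′)
open import Data.List.Relation.Unary.All as All using (All; []; _∷_)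
open import Data.List.Relation.Unary.All.Properties using (all-filter; ∷ʳ⁺)
open import Data.List.Relation.Unary.Any using (here; there)
open import Data.Maybe.Base using (just; nothing)
open import Data.Nat.Base using (ℕ; zero; suc; _+_; _*_; _∸_; _≤_; parity; z≤n; s≤s; s≤s⁻¹; pred)
  renaming (_<_ to _<ᴺ_)
open import Data.Nat.Properties
  using (≤-reflexive; ≤-trans; <-trans; +-comm; +-suc; +-monoˡ-≤; ∸-monoˡ-≤; m≤n+m; +-∸-assoc; *-suc) renaming (_≟_ to _≟ᴺ_)
open import Data.Parity.Base using (Parity; 0ℙ; 1ℙ; _⁻¹)
open import Data.Parity.Properties using (_≟_; suc-homo-⁻¹; ⁻¹-selfInverse; ⁻¹-involutive; ⁻¹-injective; p≢p⁻¹)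
open import Data.Product.Base using (_×_; _,_; ∃; ∃-syntax)
open import Data.Sum.Base using (_⊎_; inj₁; inj₂)
open import Data.Unit.Base using (tt)
open import Function.Base using (id; _∘_)
open import Induction.WellFounded using (Acc; acc)
open import Relation.Binary.PropositionalEquality
  using (_≡_; _≢_; refl; sym; trans; cong; subst; module ≡-Reasoning)
open import Relation.Nullary.Decidable using (Dec; yes; no; _×-dec_; ¬?)
open import Relation.Nullary.Negation using (¬_; contradiction)
open import Relation.Unary using (Pred; Decidable)

import Data.List.Membership.DecPropositional as DecMembership

-- Parities, subtraction and lists.

≢⇒≡⁻¹ : ∀ {p q : Parity} → p ≢ q → q ≡ p ⁻¹
≢⇒≡⁻¹ {0ℙ} {0ℙ} p≢q = contradiction refl p≢q
≢⇒≡⁻¹ {0ℙ} {1ℙ} p≢q = refl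
≢⇒≡⁻¹ {1ℙ} {0ℙ} p≢q = refl
≢⇒≡⁻¹ {1ℙ} {1ℙ} p≢q = contradiction refl p≢q

-- Shaped for `residual`: since `suc l ≤ m`, the truncated subtraction is exact, so subtracting a
-- view shorter by one move gains exactly one.
∸-step : ∀ {m n l} → suc l ≤ m → m ≤ n → suc (m ∸ suc l + 1) ≤ n ∸ l + 1
∸-step {l = l} l<m m≤n =
  +-monoˡ-≤ 1 (≤-trans (≤-reflexive (sym (+-∸-assoc 1 l<m))) (∸-monoˡ-≤ l m≤n))

module _ {a p q} {A : Set a} {P : Pred A p} {Q : Pred A q}
         (P? : Decidable P) (Q? : Decidable Q) where

  filter-×-all : ∀ {xs} → All Q xs →
                 filter (λ x → P? x ×-dec Q? x) xs ≡ filter P? xs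
  filter-×-all [] = refl
  filter-×-all {x ∷ xs} (qx ∷ qxs) with P? x | Q? x
  ... | yes _ | yes _  = cong (x ∷_) (filter-×-all qxs)
  ... | yes _ | no ¬qx = contradiction qx ¬qx
  ... | no _  | _      = filter-×-all qxs

Pointwise-lookupʳ : ∀ {a b r} {A : Set a} {B : Set b} {R : A → B → Set r} {xs ys y} →
                    Pointwise R xs ys → y ∈ ys → ∃ λ x → x ∈ xs × R x y
Pointwise-lookupʳ (r ∷ rs) (here refl) = _ , here refl , r
Pointwise-lookupʳ (r ∷ rs) (there y∈)  =
  let x , x∈ , r′ = Pointwise-lookupʳ rs y∈ in x , there x∈ , r′

module _ {k : ℕ} (s : PointerStructure k) where
  open PointerStructure s

  -- Pointers and consecutive moves.

  pointer-polarity : ∀ {m j} → pointer j ≡ just m → polarity j ≡ polarity m ⁻¹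
  pointer-polarity {m} {j} j→m =
    trans (cong parity (pointer-move j→m))
          (sym (⁻¹-selfInverse (suc-homo-⁻¹ (move m))))

  first-initial : ∀ {j} → toℕ j ≡ 0 → move j ≡ 0
  first-initial {j} j≡0 with move j ≟ᴺ 0
  ... | yes mj≡0 = mj≡0
  ... | no mj≢0 with i , j→i ← pointer-defined mj≢0
    with () ← subst (toℕ i <ᴺ_) j≡0 (pointer-earlier j→i)

  -- The first move of s is already initial and initial moves are unique, so a move with a
  -- predecessor is not initial.
  next-pointer : ∀ {i j} → toℕ j ≡ suc (toℕ i) → ∃ λ m → pointer j ≡ just m
  next-pointer {i} {j} next = pointer-defined (not-initial next)
    where
    not-initial : ∀ {i j : Fin k} → toℕ j ≡ suc (toℕ i) → move j ≢ 0
    not-initial {zero}  {zero}  ()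
    not-initial {i} {suc j} _ mj≡0
      with () ← initial-unique mj≡0 (first-initial {zero} refl)

  -- Unfolding the views.

  -- Recursive calls carry accessibility proofs other than those of `<-wellFounded`; exchanging them
  -- recovers the defining equations of the views.
  viewUpToAcc-irrelevant : ∀ x j (p q : Acc _<_ j) →
    viewUpToAcc s x j p ≡ viewUpToAcc s x j q
  viewStep-irrelevant : ∀ x j (p q : Acc _<_ j) {own : Set} (own? : Dec own) t
    (earlier : ∀ {i} → t ≡ just i → i < j) →
    viewStep s x j p own? t earlier ≡ viewStep s x j q own? t earlier
  viewBeforeAcc-irrelevant : ∀ x j (p q : Acc _<_ j) →
    viewBeforeAcc s x j p ≡ viewBeforeAcc s x j q

  viewUpToAcc-irrelevant x j p q =
    viewStep-irrelevant x j p q (polarity j ≟ x) (pointer j) pointer-earlier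
  viewStep-irrelevant x j p q (yes _) t earlier =
    cong (_∷ʳ j) (viewBeforeAcc-irrelevant x j p q)
  viewStep-irrelevant x j p q (no _) nothing earlier = refl
  viewStep-irrelevant x j (acc p) (acc q) (no _) (just i) earlier =
    cong (_++ i ∷ j ∷ []) (viewBeforeAcc-irrelevant x i (p (earlier refl)) (q (earlier refl)))
  viewBeforeAcc-irrelevant x zero    p       q       = refl
  viewBeforeAcc-irrelevant x (suc j) (acc p) (acc q) =
    viewUpToAcc-irrelevant x (inject₁ j) (p _) (q _)

  viewBefore-next : ∀ x {i j} → toℕ j ≡ suc (toℕ i) → viewBefore s x j ≡ viewUpTo s x i
  viewBefore-next x {i} {suc j} next
    with refl ← toℕ-injective {i = i} {j = inject₁ j}
                  (trans (sym (cong pred next)) (sym (toℕ-inject₁ j))) =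
    viewUpToAcc-irrelevant x (inject₁ j) _ (<-wellFounded (inject₁ j))

  viewUpTo-own : ∀ {x j} → polarity j ≡ x → viewUpTo s x j ≡ viewBefore s x j ∷ʳ j
  viewUpTo-own {x} {j} own with polarity j ≟ x
  ... | yes _   = refl
  ... | no ¬own = contradiction own ¬own

  -- The pointer is a variable `t` so that its value can be matched on: `pointer j` itself also
  -- occurs in the type of `pointer-earlier`.
  viewStep-pointer : ∀ {x m j own} (ac : Acc _<_ j) (own? : Dec own) → ¬ own → ∀ t
    (earlier : ∀ {i} → t ≡ just i → i < j) → t ≡ just m →
    viewStep s x j ac own? t earlier ≡ viewBefore s x m ++ m ∷ j ∷ []
  viewStep-pointer ac (yes own) ¬own t earlier eq = contradiction own ¬own
  viewStep-pointer {x} {m} {j} (acc p) (no _) ¬own .(just m) earlier refl =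
    cong (_++ m ∷ j ∷ [])
         (viewBeforeAcc-irrelevant x m (p (earlier refl)) (<-wellFounded m))

  viewStep-initial : ∀ {x j own} (ac : Acc _<_ j) (own? : Dec own) → ¬ own → ∀ t
    (earlier : ∀ {i} → t ≡ just i → i < j) → t ≡ nothing →
    viewStep s x j ac own? t earlier ≡ j ∷ []
  viewStep-initial ac (yes own) ¬own t earlier eq = contradiction own ¬own
  viewStep-initial ac (no _) ¬own .nothing earlier refl = refl

  -- The move s_j is not one of x's own, so the view jumps from it to s_m; as s_m is own, its view
  -- is what precedes it followed by s_m.
  viewUpTo-pointer : ∀ {x m j} → polarity m ≡ x → pointer j ≡ just m →
                     viewUpTo s x j ≡ viewUpTo s x m ∷ʳ j
  viewUpTo-pointer {x} {m} {j} own j→m = begin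
    viewUpTo s x j                      ≡⟨ viewStep-pointer (<-wellFounded j) (polarity j ≟ x)
                                             (λ own′ → p≢p⁻¹ x (trans (sym own′)
                                               (trans (pointer-polarity j→m) (cong _⁻¹ own))))
                                             (pointer j) pointer-earlier j→m ⟩
    viewBefore s x m ++ m ∷ j ∷ []      ≡⟨ ++-assoc (viewBefore s x m) (m ∷ []) (j ∷ []) ⟨
    (viewBefore s x m ∷ʳ m) ∷ʳ j        ≡⟨ cong (_∷ʳ j) (viewUpTo-own own) ⟨
    viewUpTo s x m ∷ʳ j                 ∎
    where open ≡-Reasoning

  -- Views as growing lists.

  -- Basis for inductions on views: `extends` covers both an own move, with i the preceding
  -- position, and a jump along a pointer, with i its target.
  data Last (x : Parity) (j : Fin k) : Set where
    alone   : viewUpTo s x j ≡ j ∷ [] → Last x j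
    extends : ∀ {i} → i < j → viewUpTo s x j ≡ viewUpTo s x i ∷ʳ j → Last x j

  last : ∀ x j → Last x j
  last x j with polarity j ≟ x
  last x zero    | yes own = alone (viewUpTo-own own)
  last x (suc j) | yes own =
    extends {i = inject₁ j} (s≤s (≤-reflexive (toℕ-inject₁ j)))
      (trans (viewUpTo-own own)
             (cong (_∷ʳ suc j) (viewBefore-next x (cong suc (sym (toℕ-inject₁ j))))))
  last x j       | no ¬own with pointer j in eq
  ... | nothing = alone (viewStep-initial (<-wellFounded j) (polarity j ≟ x) ¬own
                                          (pointer j) pointer-earlier eq)
  ... | just m  = extends (pointer-earlier eq) (viewUpTo-pointer own eq)
    where
    own : polarity m ≡ x
    own = trans (sym (⁻¹-involutive (polarity m)))
                (trans (cong _⁻¹ (sym (pointer-polarity eq))) (sym (≢⇒≡⁻¹ ¬own)))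

  -- The bound makes the final occurrence of s_j the only one, which matters when `context` removes
  -- the move itself.
  viewUpTo-∷ʳ : ∀ x j → ∃ λ v → viewUpTo s x j ≡ v ∷ʳ j × All (_< j) v
  viewUpTo-∷ʳ x j = go j (<-wellFounded j)
    where
    go : ∀ j → Acc _<_ j → ∃ λ v → viewUpTo s x j ≡ v ∷ʳ j × All (_< j) v
    go j (acc rs) with last x j
    ... | alone eq = [] , eq , []
    ... | extends {i} i<j eq =
      let v , eqᵢ , v<i = go i (rs i<j)
      in viewUpTo s x i , eq ,
         subst (All (_< j)) (sym eqᵢ) (∷ʳ⁺ (All.map (λ l<i → <-trans l<i i<j) v<i) i<j)

  ∈-viewUpTo : ∀ x j → j ∈ viewUpTo s x j
  ∈-viewUpTo x j with v , eq , _ ← viewUpTo-∷ʳ x j =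
    subst (j ∈_) (sym eq) (∈-++⁺ʳ v (here refl))

  -- By `last`, a view arises by appending one move at a time to views of earlier positions, so s_l
  -- entered it as the last move of its own view.
  viewUpTo-⊆ : ∀ x j {l} → l ∈ viewUpTo s x j → viewUpTo s x l ⊆ viewUpTo s x j
  viewUpTo-⊆ x j = go j (<-wellFounded j)
    where
    go : ∀ j → Acc _<_ j → ∀ {l} → l ∈ viewUpTo s x j → viewUpTo s x l ⊆ viewUpTo s x j
    go j (acc rs) {l} l∈ with last x j
    ... | alone eq with here refl ← subst (l ∈_) eq l∈ = ⊆-refl
    ... | extends {i} i<j eq with ∈-++⁻ (viewUpTo s x i) (subst (l ∈_) eq l∈)
    ...   | inj₁ l∈ᵢ         = subst (_ ∈_) (sym eq) ∘ ∈-++⁺ˡ ∘ go i (rs i<j) l∈ᵢ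
    ...   | inj₂ (here refl) = ⊆-refl

  -- Residual sizes.

  open DecMembership (_≟ᶠ_ {k}) using (_∈?_)

  -- Every view through s_j goes through s_i, so the maximum for s_j is no larger; subtracting a
  -- view longer by one makes the inequality strict.
  residual-decreases : ∀ {x i j} → viewUpTo s x j ≡ viewUpTo s x i ∷ʳ j →
                       residual s x j <ᴺ residual s x i
  residual-decreases {x} {i} {j} eq =
    subst (λ n → suc (longest j ∸ n + 1) ≤ residual s x i) (sym length-j)
      (∸-step (subst (_≤ longest j) length-j longest-j)
              (max-mono-⊆ z≤n (map⁺ _ (filter⁺′ (λ l → j ∈? viewUpTo s x l)
                                                (λ l → i ∈? viewUpTo s x l)
                                                j∈⇒i∈ {allFin k} ⊆-refl))))
    where
    longest : Fin k → ℕ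
    longest i = max 0 (map (λ l → length (viewUpTo s x l))
                           (filter (λ l → i ∈? viewUpTo s x l) (allFin k)))

    length-j : length (viewUpTo s x j) ≡ suc (length (viewUpTo s x i))
    length-j = trans (cong length eq)
                     (trans (length-++ (viewUpTo s x i)) (+-comm _ 1))

    -- The view of s_{≤ j} is itself one of the views measured, so the subtraction is exact.
    longest-j : length (viewUpTo s x j) ≤ longest j
    longest-j = All.lookup (xs≤max 0 _)
      (∈-map⁺ _ (∈-filter⁺ (λ l → j ∈? viewUpTo s x l) (∈-allFin j) (∈-viewUpTo x j)))

    j∈⇒i∈ : ∀ {l} → j ∈ viewUpTo s x l → i ∈ viewUpTo s x l
    j∈⇒i∈ {l} j∈ = viewUpTo-⊆ x l j∈ (subst (i ∈_) (sym eq) (∈-++⁺ˡ (∈-viewUpTo x i)))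

  -- Residual depth.

  -- Each pointer of the chain leads to a strictly later position, so the chain ends at position
  -- `toℕ i + n` or beyond.
  Chain-bound : ∀ n {i} → Chain s n i → toℕ i + n <ᴺ k
  Chain-bound zero    {i} _ = subst (_<ᴺ k) (+-comm 0 (toℕ i)) (toℕ<n i)
  Chain-bound (suc n) {i} (j , j→i , c) =
    ≤-trans (s≤s (≤-trans (≤-reflexive (+-suc (toℕ i) n)) (+-monoˡ-≤ n (pointer-earlier j→i))))
            (Chain-bound n c)

  Chain-rdepth : ∀ i → Chain s (rdepth s i) i
  Chain-rdepth i =
    -- The maximum is attained: `tt` is the chain without pointers for the default 0, and the filter
    -- supplies the other chains.
    argmax-all id {P = λ n → Chain s n i} tt (all-filter (λ n → chain? s n i) (upTo k))

  Chain⇒≤rdepth : ∀ n {i} → Chain s n i → n ≤ rdepth s i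
  Chain⇒≤rdepth n {i} c = All.lookup (xs≤max 0 _)
    (∈-filter⁺ (λ n → chain? s n i) (∈-upTo⁺ (≤-trans (s≤s (m≤n+m n (toℕ i))) (Chain-bound n c))) c)

  -- Prepending the pointer from s_j to s_m to a longest chain from s_j gives a chain from s_m.
  rdepth-decreases : ∀ {m j} → pointer j ≡ just m → rdepth s j <ᴺ rdepth s m
  rdepth-decreases {j = j} j→m = Chain⇒≤rdepth (suc (rdepth s j)) (j , j→m , Chain-rdepth j)

  -- Contexts and cocontexts.

  context-∷ʳ : ∀ {i v} → viewUpTo s (polarity i ⁻¹) i ≡ v ∷ʳ i →
               context s i ≡ filter (λ m → polarity m ≟ polarity i) v
  context-∷ʳ {i} {v} eq
    with w , eq′ , w<i ← viewUpTo-∷ʳ (polarity i ⁻¹) i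
    -- Identifies `v` with the list whose entries are known to lie below i, so that excluding s_i
    -- removes only the last entry.
    with refl ← ∷ʳ-injectiveˡ w v (trans (sym eq′) eq) = begin
    filter P? (viewUpTo s (polarity i ⁻¹) i)  ≡⟨ cong (filter P?) eq ⟩
    filter P? (v ∷ʳ i)                        ≡⟨ filter-++ P? v (i ∷ []) ⟩
    filter P? v ++ filter P? (i ∷ [])         ≡⟨ cong (filter P? v ++_)
                                                   (filter-reject P? λ (_ , i≢i) → i≢i refl) ⟩
    filter P? v ++ []                         ≡⟨ ++-identityʳ _ ⟩
    filter P? v                               ≡⟨ filter-×-all (λ m → polarity m ≟ polarity i)
                                                   (λ m → ¬? (m ≟ᶠ i)) (All.map <⇒≢ᶠ w<i) ⟩
    filter (λ m → polarity m ≟ polarity i) v  ∎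
    where
    open ≡-Reasoning
    P? = λ m → (polarity m ≟ polarity i) ×-dec ¬? (m ≟ᶠ i)

  -- Both sides filter what precedes s_m in the same view: s_j is excluded as the move itself, s_m
  -- by its polarity.
  context-pointer : ∀ {m j} → pointer j ≡ just m → context s j ≡ cocontext s m
  context-pointer {m} {j} j→m = begin
    context s j                                   ≡⟨ context-∷ʳ view-j ⟩
    filter Q? (viewUpTo s x m)                    ≡⟨ cong (filter Q?) (viewUpTo-own refl) ⟩
    filter Q? (viewBefore s x m ∷ʳ m)             ≡⟨ filter-++ Q? (viewBefore s x m) (m ∷ []) ⟩
    filter Q? (viewBefore s x m) ++ filter Q? (m ∷ [])
                                                  ≡⟨ cong (filter Q? (viewBefore s x m) ++_)
                                                       (filter-reject Q? λ m≡j →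
                                                         p≢p⁻¹ x (trans m≡j opposite)) ⟩
    filter Q? (viewBefore s x m) ++ []            ≡⟨ ++-identityʳ _ ⟩
    filter Q? (viewBefore s x m)                  ≡⟨ cong (λ y → filter (λ l → polarity l ≟ y)
                                                                       (viewBefore s x m)) opposite ⟩
    cocontext s m                                 ∎
    where
    open ≡-Reasoning
    x = polarity m
    Q? = λ l → polarity l ≟ polarity j

    opposite : polarity j ≡ x ⁻¹
    opposite = pointer-polarity j→m

    view-j : viewUpTo s (polarity j ⁻¹) j ≡ viewUpTo s x m ∷ʳ j
    view-j = subst (λ y → viewUpTo s y j ≡ viewUpTo s x m ∷ʳ j)
                   (sym (trans (cong _⁻¹ opposite) (⁻¹-involutive x)))
                   (viewUpTo-pointer refl j→m)

  -- From cotraces to traces along a pointer.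

  rsize-pointer : ∀ {m j} → pointer j ≡ just m → rsize s j <ᴺ rcosize s m
  rsize-pointer {m} {j} j→m =
    subst (λ y → residual s y j <ᴺ rcosize s m)
          (sym (trans (cong _⁻¹ (pointer-polarity j→m)) (⁻¹-involutive (polarity m))))
          (residual-decreases (viewUpTo-pointer refl j→m))

  CoTr⇒Tr : ∀ {a m j} → pointer j ≡ just m → CoTr s a m → Tr s a j
  CoTr⇒Tr j→m (cotr {n = n} size as) =
    -- The strict decrease absorbs the 1 in `2 * n + 1`.
    tr (s≤s⁻¹ (≤-trans (rsize-pointer j→m) (≤-trans size (≤-reflexive (+-comm (2 * n) 1)))))
       (subst (Pointwise _ _) (sym (context-pointer j→m)) as)

  -- The move following s_i.

  module _ {i j : Fin k} (next : toℕ j ≡ suc (toℕ i)) where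

    next-polarity : polarity j ≡ polarity i ⁻¹
    next-polarity = ≢⇒≡⁻¹ (alternating next)

    -- Unlike `context`, the cocontext filters by polarity alone, so it keeps s_i as its last entry.
    cocontext-next : cocontext s j ≡ context s i ∷ʳ i
    cocontext-next
      rewrite next-polarity | viewBefore-next (polarity i ⁻¹) next | ⁻¹-involutive (polarity i)
      with v , eq , _ ← viewUpTo-∷ʳ (polarity i ⁻¹) i = begin
      filter Q? (viewUpTo s (polarity i ⁻¹) i)  ≡⟨ cong (filter Q?) eq ⟩
      filter Q? (v ∷ʳ i)                        ≡⟨ filter-++ Q? v (i ∷ []) ⟩
      filter Q? v ++ filter Q? (i ∷ [])         ≡⟨ cong (filter Q? v ++_) (filter-accept Q? refl) ⟩
      filter Q? v ∷ʳ i                          ≡⟨ cong (_∷ʳ i) (context-∷ʳ eq) ⟨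
      context s i ∷ʳ i                          ∎
      where
      open ≡-Reasoning
      Q? = λ l → polarity l ≟ polarity i

    rcosize-next : rcosize s j <ᴺ rsize s i
    rcosize-next = subst (λ y → residual s y j <ᴺ rsize s i) (sym next-polarity)
      (residual-decreases (trans (viewUpTo-own next-polarity)
                                 (cong (_∷ʳ j) (viewBefore-next (polarity i ⁻¹) next))))

    -- Visibility places s_m in the view from which the context is filtered; s_m and s_i have the
    -- same polarity, both being opposite to s_j.
    pointer-context : Visible s → ∀ {m} → pointer j ≡ just m → m ≡ i ⊎ m ∈ context s i
    pointer-context visible {m} j→m with m ≟ᶠ i
    ... | yes m≡i = inj₁ m≡i
    ... | no m≢i  = inj₂ (∈-filter⁺ (λ m → (polarity m ≟ polarity i) ×-dec ¬? (m ≟ᶠ i))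
                                    m∈view (⁻¹-injective same , m≢i))
      where
      m∈view : m ∈ viewUpTo s (polarity i ⁻¹) i
      m∈view = subst (m ∈_) (trans (cong (λ x → viewBefore s x j) next-polarity)
                                   (viewBefore-next (polarity i ⁻¹) next))
                     (visible j→m)

      same : polarity m ⁻¹ ≡ polarity i ⁻¹
      same = trans (sym (pointer-polarity j→m)) next-polarity

    Tr⇒CoTr : ∀ {n as d b} → Tr s (suc n [ as ]) i → CoTr s b i → rdepth s i ≤ d →
              CoTr s (n [ as ∷ʳ (d , b) ]) j
    Tr⇒CoTr {n} (tr size ctx) cob depth =
      -- The bound `2 * suc n` exceeds the required `2 * n + 1` by one, and the strict decrease
      -- makes up for it.
      cotr (s≤s⁻¹ (≤-trans rcosize-next (≤-trans size (≤-reflexive 2[1+n]≡))))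
           (subst (Pointwise _ _) (sym cocontext-next) (++⁺ ctx (fits cob depth ∷ [])))
      where
      2[1+n]≡ : 2 * suc n ≡ suc (2 * n + 1)
      2[1+n]≡ = trans (*-suc 2 n) (cong suc (+-comm 1 (2 * n)))

proposition3p9 : ∀ {k : ℕ} (s : PointerStructure k) → Visible s →
    (i : Fin k) (a b : Skeleton) (d : ℕ) →
    ⟨ s , i ⟩∈ a ⋆[ d ] b →
    (j : Fin k) → toℕ j ≡ suc (toℕ i) →
    ∃[ a′ ] ∃[ b′ ] ∃[ d′ ] ((a , d , b) ↝ (a′ , d′ , b′)) × (⟨ s , j ⟩∈ a′ ⋆[ d′ ] b′)
proposition3p9 s visible i (zero [ as ]) b d (tr size _ , _) j next
  -- With root label 0 the residual size of s_i is at most 0, leaving no room for the smaller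
  -- residual cosize of a next move.
  with () ← ≤-trans (rcosize-next s next) size
proposition3p9 s visible i (suc n [ as ]) b d (tra@(tr _ ctx) , cob , depth) j next
  with m , j→m ← next-pointer s next
  with pointer-context s next visible j→m
... | inj₁ refl
  -- Depth strictly decreases along the pointer, so the bound `d` is a successor, as `toArg`
  -- requires.
  with s≤s depthⱼ ← ≤-trans (rdepth-decreases s j→m) depth =
  _ , _ , _ , toArg , CoTr⇒Tr s j→m cob , Tr⇒CoTr s next tra cob depth , depthⱼ
... | inj₂ m∈
  -- The subtree to select is the one matched with s_m in the enumeration of the context.
  with (_ , aₘ) , a∈ , fits coa depthₘ ← Pointwise-lookupʳ ctx m∈
  with s≤s depthⱼ ← ≤-trans (rdepth-decreases s j→m) depthₘ =
  _ , _ , _ , toChild a∈ , CoTr⇒Tr s j→m coa , Tr⇒CoTr s next tra cob depth , depthⱼ
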